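{- Let $\pi^-$ be the inverse of $\pi\in IP(n,k)$, with characteristic function $\varphi^-$. Then the corresponding idempotent map $\iota\in I(n,k)$ can be determined from $\pi^-$ in $\mathcal{O}(n)$ time by $$\iota(\pi^-(i))=\begin{cases}\pi^-(i)&\text{if }\varphi^-(i)=1,\\ \iota(\pi^-(i-1))&\text{otherwise},\end{cases}\qquad i=1,2,\ldots,n.$$
   Context: $[n]=\{1,\ldots,n\}$. $I(n,k)$ is the set of idempotent maps $\iota:[n]\to[n]$ ($\iota(\iota(x))=\iota(x)$ for all $x$) with image of cardinality $k$. An idempotent permutation of degree $k$ ($1\le k\le n$) is a permutation $\pi$ of $[n]$ together with a distinguished set of indices $A=\{a_1<\cdots<a_k\}\subseteq[n]$ such that the values $c_i=\pi(a_i)$ satisfy $1=c_1<c_2<\cdots<c_k$; put $c_{k+1}=n+1$ and $[a_i]_\pi=\{x\in[n]:c_i\le\pi(x)<c_{i+1}\}$. $IP(n,k)$ denotes the set of idempotent permutations of degree $k$. The idempotent map corresponding to $\pi$ is the map $\iota\in I(n,k)$ with $\iota(x)=a_i$ for all $x\in[a_i]_\pi$, $i=1,\ldots,k$. $\pi^-$ is the inverse permutation, and $\varphi^-:[n]\to\{0,1\}$ is given by $\varphi^-(x)=1$ if $x\in\{c_1,\ldots,c_k\}$ and $0$ otherwise (in particular $\varphi^-(1)=1$). The formula is evaluated successively for $i=1,2,\ldots,n$. Time is on a unit-cost random access machine. -}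

module Defs where

open import Data.Bool.Base using (Bool; true; false; if_then_else_)
open import Data.Fin.Base as Fin using (Fin; zero; suc; toℕ; fromℕ<)
open import Data.Fin.Permutation using (Permutation′; _⟨$⟩ʳ_; flip; inverseʳ)
open import Data.Fin.Properties as Fin using (any?; toℕ-fromℕ<; fromℕ<-toℕ; toℕ<n; toℕ-injective)
open import Data.Fin.Subset as Subset using (Subset; inside; outside; ∣_∣; _∈_; _∉_; ⁅_⁆)
open import Data.Fin.Subset.Properties as Subset
  using (x∈⁅x⁆; x∈⁅y⁆⇒x≡y; x∈p∧x∉q⇒x∈p─q; p─q⊆p; Empty-unique; ∣⊥∣≡0; p─⊥≡p)
open import Data.List.Base as List using (List; []; _∷_; _++_)
open import Data.Nat.Base
open import Data.Nat.Properties
open import Data.Product.Base using (∃; _×_; _,_; proj₁; proj₂)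
open import Data.Sum.Base using (inj₁; inj₂)
open import Data.Vec.Base as Vec using ([]; _∷_; here; there)
open import Data.Vec.Properties using (lookup∘tabulate; lookup⇒[]=; []=⇒lookup)
open import Relation.Binary.Definitions using (tri<; tri≈; tri>)
open import Relation.Binary.PropositionalEquality
open import Relation.Nullary using (yes; no; does; contradiction)
open import Relation.Nullary.Decidable using (dec-true)
open import Function.Base using (_∘_)

------------------------------------------------------------------------
-- Idempotent maps and idempotent permutations

-- [n] is represented by Fin n; val x ∈ {1,…,n} is the number that x
-- stands for.
val : ∀ {n} → Fin n → ℕ
val x = suc (toℕ x)

image : ∀ {m n} → (Fin m → Fin n) → Subset n
image f = Vec.tabulate λ y → does (any? λ x → f x Fin.≟ y)

record IdempotentMap (n k : ℕ) : Set where
  field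
    map        : Fin n → Fin n
    idempotent : ∀ x → map (map x) ≡ map x
    ∣image∣≡k  : ∣ image map ∣ ≡ k

-- The distinguished set A = {a₁ < ⋯ < aₖ} is given by its increasing
-- enumeration a.
record IdempotentPermutation (n k : ℕ) : Set where
  field
    1≤k : 1 ≤ k
    k≤n : k ≤ n
    π   : Permutation′ n
    a   : Fin k → Fin n

  c : Fin k → Fin n
  c i = π ⟨$⟩ʳ a i

  field
    a-increasing : ∀ {i j} → i Fin.< j → a i Fin.< a j
    c-increasing : ∀ {i j} → i Fin.< j → c i Fin.< c j
    c₁≡1         : val (c (fromℕ< 1≤k)) ≡ 1

  -- bound m is c_{m+1}, where c_{k+1} = n + 1.
  bound : ℕ → ℕ
  bound m with m <? k
  ... | yes m<k = val (c (fromℕ< m<k))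
  ... | no  _   = suc n

  -- x ∈[a i ] is the membership of x in the block [a_i]_π.
  _∈[a_] : Fin n → Fin k → Set
  x ∈[a i ] = val (c i) ≤ val (π ⟨$⟩ʳ x) × val (π ⟨$⟩ʳ x) < bound (suc (toℕ i))

  Corresponding : IdempotentMap n k → Set
  Corresponding ι = ∀ i x → x ∈[a i ] → IdempotentMap.map ι x ≡ a i

  π⁻ : Fin n → Fin n
  π⁻ i = flip π ⟨$⟩ʳ i

  -- The values 1 and 0 are true and false.
  φ⁻ : Fin n → Bool
  φ⁻ x = does (any? λ i → c i Fin.≟ x)

  -- Fin.pred i is i − 1, except at the first index, where it is junk; that
  -- value is not used, because φ⁻ is true there (φ⁻-first below).
  Formula : (Fin n → Fin n) → Set
  Formula f = ∀ i → f (π⁻ i) ≡ (if φ⁻ i then π⁻ i else f (π⁻ (Fin.pred i)))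

------------------------------------------------------------------------
-- Unit-cost random access machine

-- A machine has registers and a memory, both indexed by ℕ and holding
-- natural numbers of unbounded size.  Every instruction takes one unit of
-- time.  Multiplication is not available.
data Instr : Set where
  const : (r v : ℕ) → Instr       -- r := v
  copy  : (r s : ℕ) → Instr       -- r := s
  add   : (r s t : ℕ) → Instr     -- r := s + t
  sub   : (r s t : ℕ) → Instr     -- r := max(s − t, 0)
  load  : (r s : ℕ) → Instr       -- r := mem[s]
  store : (r s : ℕ) → Instr       -- mem[r] := s
  jump  : (l : ℕ) → Instr
  jzero : (r l : ℕ) → Instr       -- jump to l if r = 0
  halt  : Instr

Program : Set
Program = List Instr

record State : Set where
  constructor ⟨_,_,_⟩
  field
    pc  : ℕ
    reg : ℕ → ℕ
    mem : ℕ → ℕ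

open State public

_[_≔_] : (ℕ → ℕ) → ℕ → ℕ → (ℕ → ℕ)
(f [ x ≔ v ]) y = if y ≡ᵇ x then v else f y

nth : ∀ {A : Set} → A → List A → ℕ → A
nth d []       _       = d
nth d (x ∷ xs) zero    = x
nth d (x ∷ xs) (suc m) = nth d xs m

exec : Instr → State → State
exec (const r v) ⟨ l , R , M ⟩ = ⟨ suc l , R [ r ≔ v ] , M ⟩
exec (copy r s)  ⟨ l , R , M ⟩ = ⟨ suc l , R [ r ≔ R s ] , M ⟩
exec (add r s t) ⟨ l , R , M ⟩ = ⟨ suc l , R [ r ≔ R s + R t ] , M ⟩
exec (sub r s t) ⟨ l , R , M ⟩ = ⟨ suc l , R [ r ≔ R s ∸ R t ] , M ⟩
exec (load r s)  ⟨ l , R , M ⟩ = ⟨ suc l , R [ r ≔ M (R s) ] , M ⟩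
exec (store r s) ⟨ l , R , M ⟩ = ⟨ suc l , R , M [ R r ≔ R s ] ⟩
exec (jump l′)   ⟨ l , R , M ⟩ = ⟨ l′ , R , M ⟩
exec (jzero r l′) ⟨ l , R , M ⟩ = ⟨ (if R r ≡ᵇ 0 then l′ else suc l) , R , M ⟩
exec halt        s             = s

-- Leaving the program text also halts the machine.
fetch : Program → State → Instr
fetch p s = nth halt p (pc s)

run : Program → ℕ → State → State
run p zero    s = s
run p (suc t) s = run p t (exec (fetch p s) s)

Halted : Program → State → Set
Halted p s = fetch p s ≡ halt

------------------------------------------------------------------------
-- Computing the map on the machine

bit : Bool → ℕ
bit b = if b then 1 else 0

module _ {n k : ℕ} (P : IdempotentPermutation n k) where
  open IdempotentPermutation P

  -- The input is n, π⁻(1), …, π⁻(n), φ⁻(1), …, φ⁻(n) in cells 0, …, 2n.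
  -- All other cells and all registers are 0.
  input : List ℕ
  input = n ∷ List.tabulate (val ∘ π⁻) ++ List.tabulate (bit ∘ φ⁻)

  start : State
  start = ⟨ 0 , (λ _ → 0) , nth 0 input ⟩

  -- The value for x is returned in cell 2n + x.
  output : State → Fin n → ℕ
  output s x = mem s (n + n + val x)

  -- p computes f within T units of time.  The values are determined
  -- successively: at time `stage i`, exactly f(π⁻(1)), …, f(π⁻(i)) have
  -- been entered in the output.
  record Evaluates (p : Program) (T : ℕ) (f : Fin n → Fin n) : Set where
    field
      stage            : Fin n → ℕ
      stage-increasing : ∀ {i j} → i Fin.< j → stage i < stage j
      stage-output     : ∀ i j → output (run p (stage i) start) (π⁻ j) ≡
                           (if does (j Fin.≤? i) then val (f (π⁻ j)) else 0)
      time             : ℕ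
      stage≤time       : ∀ i → stage i ≤ time
      time≤T           : time ≤ T
      halted           : Halted p (run p time start)
      result           : ∀ x → output (run p time start) x ≡ val (f x)

------------------------------------------------------------------------
-- Every idempotent permutation has a corresponding idempotent map

private
  ∣p∣≡1+∣p-x∣ : ∀ {n} {x : Fin n} {p} → x ∈ p → ∣ p ∣ ≡ suc ∣ p Subset.- x ∣
  ∣p∣≡1+∣p-x∣ {p = _ ∷ p} here = cong (suc ∘ ∣_∣) (sym (p─⊥≡p p))
  ∣p∣≡1+∣p-x∣ {p = inside  ∷ _} (there x∈p) = cong suc (∣p∣≡1+∣p-x∣ x∈p)
  ∣p∣≡1+∣p-x∣ {p = outside ∷ _} (there x∈p) = ∣p∣≡1+∣p-x∣ x∈p

  x∉p-x : ∀ {n} (x : Fin n) p → x ∉ p Subset.- x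
  x∉p-x zero    (_ ∷ p) ()
  x∉p-x (suc x) (_ ∷ p) (there x∈) = x∉p-x x p x∈

  enumerated-size : ∀ {n} k (a : Fin k → Fin n) (p : Subset n) →
                    (∀ {i j} → a i ≡ a j → i ≡ j) →
                    (∀ i → a i ∈ p) → (∀ {y} → y ∈ p → ∃ λ i → a i ≡ y) →
                    ∣ p ∣ ≡ k
  enumerated-size {n} zero a p inj a∈p onto =
    trans (cong ∣_∣ (Empty-unique λ { (y , y∈p) → noFin (proj₁ (onto y∈p)) })) (∣⊥∣≡0 n)
    where
    noFin : Fin 0 → _
    noFin ()
  enumerated-size (suc k) a p inj a∈p onto =
    trans (∣p∣≡1+∣p-x∣ (a∈p zero))
          (cong suc (enumerated-size k (a ∘ suc) (p Subset.- a zero)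
                      (Fin.suc-injective ∘ inj)
                      (λ i → x∈p∧x∉q⇒x∈p─q (a∈p (suc i)) (λ a∈ → suc≢0 (inj (x∈⁅y⁆⇒x≡y _ a∈))))
                      onto′))
    where
    suc≢0 : ∀ {i : Fin k} → suc i ≢ zero
    suc≢0 ()
    onto′ : ∀ {y} → y ∈ p Subset.- a zero → ∃ λ i → a (suc i) ≡ y
    onto′ y∈ with onto (p─q⊆p p ⁅ a zero ⁆ y∈)
    ... | zero  , refl = contradiction y∈ (x∉p-x (a zero) p)
    ... | suc i , eq   = i , eq

  image⁺ : ∀ {m n} (f : Fin m → Fin n) x → f x ∈ image f
  image⁺ f x = lookup⇒[]= (f x) _
    (trans (lookup∘tabulate _ (f x)) (dec-true (any? λ z → f z Fin.≟ f x) (x , refl)))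

  image⁻ : ∀ {m n} (f : Fin m → Fin n) {y} → y ∈ image f → ∃ λ x → f x ≡ y
  image⁻ f {y} y∈ with any? (λ x → f x Fin.≟ y)
                     | trans (sym (lookup∘tabulate (λ y → does (any? λ x → f x Fin.≟ y)) y))
                             ([]=⇒lookup y∈)
  ... | yes r | _  = r
  ... | no _  | ()

  bracket : ∀ (b : ℕ → ℕ) v k → b 0 ≤ v → v < b k →
            ∃ λ m → m < k × b m ≤ v × v < b (suc m)
  bracket b v zero    lo hi = contradiction (<-≤-trans hi lo) (<-irrefl refl)
  bracket b v (suc k) lo hi with ≤-<-connex (b k) v
  ... | inj₁ bk≤v = k , n<1+n k , bk≤v , hi
  ... | inj₂ v<bk with bracket b v k lo v<bk
  ...   | m , m<k , p , q = m , m<n⇒m<1+n m<k , p , q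

module _ {n k : ℕ} (P : IdempotentPermutation n k) where
  open IdempotentPermutation P

  φ⁻-first : ∀ x → val x ≡ 1 → φ⁻ x ≡ true
  φ⁻-first x x≡1 = dec-true (any? λ i → c i Fin.≟ x)
    (fromℕ< 1≤k , toℕ-injective (suc-injective (trans c₁≡1 (sym x≡1))))

  private
    bound-< : ∀ {m} (m<k : m < k) → bound m ≡ val (c (fromℕ< m<k))
    bound-< {m} m<k with m <? k
    ... | yes _   = refl
    ... | no  m≮k = contradiction m<k m≮k

    bound-k : bound k ≡ suc n
    bound-k with k <? k
    ... | yes k<k = contradiction k<k (<-irrefl refl)
    ... | no  _   = refl

    bound-toℕ : ∀ i → bound (toℕ i) ≡ val (c i)
    bound-toℕ i = trans (bound-< (toℕ<n i)) (cong (val ∘ c) (fromℕ<-toℕ i (toℕ<n i)))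

    bound-suc : ∀ i x → toℕ i < x → x ≤ k → val (c i) < bound x
    bound-suc i x i<x x≤k with x <? k
    ... | yes x<k = s≤s (c-increasing (subst (toℕ i <_) (sym (toℕ-fromℕ< x<k)) i<x))
    ... | no  _   = s≤s (toℕ<n (c i))

    a∈[a] : ∀ i → a i ∈[a i ]
    a∈[a] i = ≤-refl , bound-suc i (suc (toℕ i)) (n<1+n _) (toℕ<n i)

    a-injective : ∀ {i j} → a i ≡ a j → i ≡ j
    a-injective {i} {j} eq with Fin.<-cmp i j
    ... | tri< i<j _ _ = contradiction (cong toℕ eq) (<⇒≢ (a-increasing i<j))
    ... | tri≈ _ i≡j _ = i≡j
    ... | tri> _ _ j<i = contradiction (cong toℕ (sym eq)) (<⇒≢ (a-increasing j<i))

    disjoint-< : ∀ {i j x} → i Fin.< j → x ∈[a i ] → val (c j) ≤ val (π ⟨$⟩ʳ x) → i ≡ j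
    disjoint-< {i} {j} {x} i<j (_ , x<) c≤x = contradiction (<-≤-trans x< (≤-trans step c≤x)) (<-irrefl refl)
      where
      mono : ∀ {m} → m ≤ toℕ j → (m<k : m < k) → bound m ≤ val (c j)
      mono {m} m≤j m<k with m≤n⇒m<n∨m≡n m≤j
      ... | inj₂ refl = ≤-reflexive (bound-toℕ j)
      ... | inj₁ m<j  = subst (_≤ val (c j)) (sym (bound-< m<k))
                          (<⇒≤ (s≤s (c-increasing (subst (_< toℕ j) (sym (toℕ-fromℕ< m<k)) m<j))))
      step : bound (suc (toℕ i)) ≤ val (c j)
      step = mono i<j (≤-<-trans i<j (toℕ<n j))

    disjoint : ∀ {i j x} → x ∈[a i ] → x ∈[a j ] → i ≡ j
    disjoint {i} {j} {x} p q with Fin.<-cmp i j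
    ... | tri< i<j _ _ = disjoint-< {x = x} i<j p (proj₁ q)
    ... | tri≈ _ i≡j _ = i≡j
    ... | tri> _ _ j<i = sym (disjoint-< {x = x} j<i q (proj₁ p))

    block : ∀ x → ∃ λ i → x ∈[a i ]
    block x with bracket bound (val (π ⟨$⟩ʳ x)) k
                   (subst (_≤ _) (sym (trans (bound-< 1≤k) c₁≡1)) (s≤s z≤n))
                   (subst (_ <_) (sym bound-k) (s≤s (toℕ<n (π ⟨$⟩ʳ x))))
    ... | m , m<k , lo , hi =
      fromℕ< m<k , subst (_≤ _) (bound-< m<k) lo
                 , subst (λ m → _ < bound (suc m)) (sym (toℕ-fromℕ< m<k)) hi

    ι : Fin n → Fin n
    ι x = a (proj₁ (block x))

    ι-block : ∀ i x → x ∈[a i ] → ι x ≡ a i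
    ι-block i x x∈ = cong a (disjoint {x = x} (proj₂ (block x)) x∈)

    ι-a : ∀ i → ι (a i) ≡ a i
    ι-a i = ι-block i (a i) (a∈[a] i)

  correspondingMap : ∃ Corresponding
  correspondingMap = record
    { map        = ι
    ; idempotent = λ x → ι-a (proj₁ (block x))
    ; ∣image∣≡k  = enumerated-size k a (image ι) a-injective
                     (λ i → subst (_∈ image ι) (ι-a i) (image⁺ ι (a i)))
                     (λ y∈ → let x , eq = image⁻ ι y∈ in proj₁ (block x) , eq)
    } , ι-block

  correspondingMap-unique : ∀ ι₁ ι₂ → Corresponding ι₁ → Corresponding ι₂ →
                            IdempotentMap.map ι₁ ≗ IdempotentMap.map ι₂
  correspondingMap-unique _ _ p q x =
    let i , x∈ = block x in trans (p i x x∈) (sym (q i x x∈))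

{-# OPTIONS --safe #-}
module Submission where

-- Listed by value, [n] falls into consecutive intervals c_j, …, c_{j+1} − 1,
-- and π⁻ carries the j-th interval onto the block [a_j]_π.  A value i with
-- φ⁻(i) = 1 is the left end c_j of its interval, and π⁻(i) = a_j; any other
-- value lies in the same interval as i − 1 (block-step).  Hence the
-- corresponding map, which is constantly a_j on [a_j]_π, satisfies the formula
-- (corresponding⇒formula).  As φ⁻(1) = 1, the same distinction is an induction
-- principle on values (φ⁻-induction), by which the formula has at most one
-- solution (formula-unique).
--
-- The program reads the formula off literally: a single loop for i = 1, …, n
-- keeps ι(π⁻(i)) in a register, replaces it by π⁻(i) whenever φ⁻(i) = 1, and
-- stores it in the output cell of π⁻(i).  Both outcomes of the test on φ⁻(i)
-- take the same time, so one round takes exactly 12 instructions.  With 3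
-- instructions before the loop and one to leave it, the time is
-- 12n + 4 ≤ 16n, since n ≥ 1.  The loop invariant (Invariant) is preserved
-- because f obeys the formula and π⁻ is injective, so that no output cell is
-- written twice.

open import Defs
open import Data.Bool.Base using (Bool; true; false; if_then_else_)
open import Data.Fin.Base as Fin using (Fin; zero; suc; toℕ; fromℕ<)
open import Data.Fin.Induction using (<-weakInduction)
open import Data.Fin.Permutation using (_⟨$⟩ʳ_; inverseˡ; inverseʳ)
open import Data.Fin.Properties as Fin
  using (any?; toℕ<n; toℕ-fromℕ<; toℕ-inject₁; toℕ-injective)
open import Data.List.Base as List using ([]; _∷_; _++_)
open import Data.Nat.Base
open import Data.Nat.Properties
open import Data.Product.Base using (∃-syntax; _×_; _,_; proj₁; proj₂)
open import Data.Sum.Base using (inj₁; inj₂)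
open import Function.Base using (_∘_)
open import Relation.Binary.PropositionalEquality
open import Relation.Nullary using (Dec; yes; no; does; contradiction)
open import Relation.Nullary.Decidable using (dec-true)
open IdempotentMap using (map)
open IdempotentPermutation using (Corresponding; Formula)

------------------------------------------------------------------------
-- Blocks and the formula

module _ {n k : ℕ} (P : IdempotentPermutation n k) where
  open IdempotentPermutation P hiding (Corresponding; Formula)

  π-π⁻ : ∀ i → π ⟨$⟩ʳ π⁻ i ≡ i
  π-π⁻ i = inverseʳ π

  π⁻-π : ∀ x → π⁻ (π ⟨$⟩ʳ x) ≡ x
  π⁻-π x = inverseˡ π

  π⁻-injective : ∀ {i j} → π⁻ i ≡ π⁻ j → i ≡ j
  π⁻-injective {i} {j} eq = trans (sym (π-π⁻ i)) (trans (cong (π ⟨$⟩ʳ_) eq) (π-π⁻ j))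

  φ⁻-c : ∀ j → φ⁻ (c j) ≡ true
  φ⁻-c j = dec-true (any? λ i → c i Fin.≟ c j) (j , refl)

  φ⁻-true : ∀ i → φ⁻ i ≡ true → ∃[ j ] c j ≡ i
  φ⁻-true i eq with any? (λ j → c j Fin.≟ i)
  φ⁻-true i eq | yes ex = ex
  φ⁻-true i () | no _

  -- The index i is not the first one, so Fin.pred i really is i − 1.
  val-pred : ∀ i → φ⁻ i ≡ false → val i ≡ suc (val (Fin.pred i))
  val-pred zero    φ≡0 = contradiction (trans (sym φ≡0) (φ⁻-first P zero refl)) λ ()
  val-pred (suc i) φ≡0 = cong (2 +_) (sym (toℕ-inject₁ i))

  -- The order in which the formula determines its values.
  φ⁻-induction : (Q : Fin n → Set) →
                 (∀ i → φ⁻ i ≡ true → Q i) →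
                 (∀ i → φ⁻ i ≡ false → Q (Fin.pred i) → Q i) →
                 ∀ i → Q i
  φ⁻-induction Q base step i = go i Q (λ j j≡1 → base j (φ⁻-first P j j≡1)) pred-step i
    where
    pred-step : ∀ i → Q (Fin.pred i) → Q i
    pred-step i q with φ⁻ i in φ≡
    ... | true  = base i φ≡
    ... | false = step i φ≡ q
    -- The first argument only exhibits Fin m as nonempty.
    go : ∀ {m} → Fin m → (R : Fin m → Set) → (∀ j → val j ≡ 1 → R j) →
         (∀ j → R (Fin.pred j) → R j) → ∀ j → R j
    go {suc m} _ R first next = <-weakInduction R (first zero refl) (λ j → next (suc j))

  a∈[a] : ∀ j → a j ∈[a j ]
  a∈[a] j = ≤-refl , below
    where
    below : val (c j) < bound (suc (toℕ j))
    below with suc (toℕ j) <? k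
    ... | yes j+1<k = s≤s (c-increasing (≤-reflexive (sym (toℕ-fromℕ< j+1<k))))
    ... | no  _     = s≤s (toℕ<n (c j))

  -- A bound is n + 1, which exceeds i, or some c_j.  If c_j exceeds i − 1 but not
  -- i, then i = c_j, so that φ⁻(i) = 1.
  bound-step : ∀ m i → φ⁻ i ≡ false → val (Fin.pred i) < bound m → val i < bound m
  bound-step m i φ≡0 lt with m <? k
  ... | no  _   = s≤s (toℕ<n i)
  ... | yes m<k with m≤n⇒m<n∨m≡n (subst (_≤ val (c (fromℕ< m<k))) (sym (val-pred i φ≡0)) lt)
  ...   | inj₁ i<c = i<c
  ...   | inj₂ i≡c = contradiction
          (trans (sym φ≡0) (trans (cong φ⁻ (toℕ-injective (suc-injective i≡c))) (φ⁻-c (fromℕ< m<k))))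
          λ ()

  block-step : ∀ i j → φ⁻ i ≡ false → π⁻ (Fin.pred i) ∈[a j ] → π⁻ i ∈[a j ]
  block-step i j φ≡0 (lo , hi)
    rewrite π-π⁻ i | π-π⁻ (Fin.pred i)
    = ≤-trans lo (≤-trans (n≤1+n _) (≤-reflexive (sym (val-pred i φ≡0))))
    , bound-step (suc (toℕ j)) i φ≡0 hi

  π⁻-c : ∀ j → π⁻ (c j) ≡ a j
  π⁻-c j = π⁻-π (a j)

  block-c : ∀ i → φ⁻ i ≡ true → ∃[ j ] π⁻ i ≡ a j × π⁻ i ∈[a j ]
  block-c i φ≡1 with φ⁻-true i φ≡1
  ... | j , refl = j , π⁻-c j , subst _∈[a j ] (sym (π⁻-c j)) (a∈[a] j)

  block : ∀ i → ∃[ j ] π⁻ i ∈[a j ]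
  block = φ⁻-induction (λ i → ∃[ j ] π⁻ i ∈[a j ])
    (λ i φ≡1 → let j , _ , i∈ = block-c i φ≡1 in j , i∈)
    (λ i φ≡0 (j , i-1∈) → j , block-step i j φ≡0 i-1∈)

  formula-true : ∀ f → Formula P f → ∀ i → φ⁻ i ≡ true → f (π⁻ i) ≡ π⁻ i
  formula-true f F i φ≡1 =
    trans (F i) (cong (λ b → if b then π⁻ i else f (π⁻ (Fin.pred i))) φ≡1)

  formula-false : ∀ f → Formula P f → ∀ i → φ⁻ i ≡ false → f (π⁻ i) ≡ f (π⁻ (Fin.pred i))
  formula-false f F i φ≡0 =
    trans (F i) (cong (λ b → if b then π⁻ i else f (π⁻ (Fin.pred i))) φ≡0)

  corresponding⇒formula : ∀ ι → Corresponding P ι → Formula P (map ι)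
  corresponding⇒formula ι corr i with φ⁻ i in φ≡
  ... | true  = let j , i≡a , i∈ = block-c i φ≡
                in trans (corr j (π⁻ i) i∈) (sym i≡a)
  ... | false = let j , i-1∈ = block (Fin.pred i)
                in trans (corr j (π⁻ i) (block-step i j φ≡ i-1∈))
                         (sym (corr j (π⁻ (Fin.pred i)) i-1∈))

  formula-unique : ∀ f g → Formula P f → Formula P g → f ≗ g
  formula-unique f g F G x = subst (λ y → f y ≡ g y) (π⁻-π x) (agree (π ⟨$⟩ʳ x))
    where
    agree : ∀ i → f (π⁻ i) ≡ g (π⁻ i)
    agree = φ⁻-induction (λ i → f (π⁻ i) ≡ g (π⁻ i))
      (λ i φ≡1 → trans (formula-true f F i φ≡1) (sym (formula-true g G i φ≡1)))
      (λ i φ≡0 ih → trans (formula-false f F i φ≡0) (trans ih (sym (formula-false g G i φ≡0))))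

------------------------------------------------------------------------
-- Memory and runs

update-same : ∀ M x v → (M [ x ≔ v ]) x ≡ v
update-same M x v with x ≡ᵇ x | ≡⇒≡ᵇ x x refl
... | true | _ = refl

update-other : ∀ M {x y} v → y ≢ x → (M [ x ≔ v ]) y ≡ M y
update-other M {x} {y} v y≢x with y ≡ᵇ x | ≡ᵇ⇒≡ y x
... | true  | y≡x = contradiction (y≡x _) y≢x
... | false | _   = refl

module _ {A : Set} (d : A) where

  nth-tabulate-++ : ∀ {n} (g : Fin n → A) ys i → nth d (List.tabulate g ++ ys) (toℕ i) ≡ g i
  nth-tabulate-++ g ys zero    = refl
  nth-tabulate-++ g ys (suc i) = nth-tabulate-++ (g ∘ suc) ys i

  nth-tabulate : ∀ {n} (g : Fin n → A) i → nth d (List.tabulate g) (toℕ i) ≡ g i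
  nth-tabulate g zero    = refl
  nth-tabulate g (suc i) = nth-tabulate (g ∘ suc) i

  nth-drop : ∀ {n} (g : Fin n → A) ys m → nth d (List.tabulate g ++ ys) (n + m) ≡ nth d ys m
  nth-drop {zero}  g ys m = refl
  nth-drop {suc n} g ys m = nth-drop (g ∘ suc) ys m

  nth-beyond : ∀ {n} (g : Fin n → A) m → nth d (List.tabulate g) (n + m) ≡ d
  nth-beyond {zero}  g m = refl
  nth-beyond {suc n} g m = nth-beyond (g ∘ suc) m

run-+ : ∀ p s t σ → run p (s + t) σ ≡ run p t (run p s σ)
run-+ p zero    t σ = refl
run-+ p (suc s) t σ = run-+ p s t (exec (fetch p σ) σ)

------------------------------------------------------------------------
-- The program

-- Registers: 0 holds the constant 1; 1 holds n; 3 holds i; 4 holds the number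
-- of rounds left; 5 holds π⁻(i); 6 holds the current value of the map;
-- 7 holds an address; 8 holds φ⁻(i).  Register 2 stays 0.
program : Program
program =
    const 0 1       --  0
  ∷ load  1 2       --  1
  ∷ copy  4 1       --  2
  ∷ jzero 4 16      --  3: head of the loop; 16 is outside the program
  ∷ add   3 0 3     --  4
  ∷ load  5 3       --  5
  ∷ add   7 1 3     --  6
  ∷ load  8 7       --  7
  ∷ jzero 8 15      --  8
  ∷ copy  6 5       --  9
  ∷ add   7 1 1     -- 10
  ∷ add   7 7 5     -- 11
  ∷ store 7 6       -- 12
  ∷ sub   4 4 0     -- 13
  ∷ jump  3         -- 14
  ∷ jump  10        -- 15: takes the time of instruction 9
  ∷ []

-- The effect of one round on arbitrary registers R and memory M, b being the
-- value of φ⁻ that is read.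
round : ∀ b {r} R M → R 4 ≡ suc r → M (R 1 + (R 0 + R 3)) ≡ bit b →
        ∃[ R′ ] run program 12 ⟨ 3 , R , M ⟩
                  ≡ ⟨ 3 , R′ , M [ R 1 + R 1 + M (R 0 + R 3) ≔ R′ 6 ] ⟩
              × R′ 0 ≡ R 0 × R′ 1 ≡ R 1 × R′ 3 ≡ R 0 + R 3 × R′ 4 ≡ R 4 ∸ R 0
              × R′ 6 ≡ (if b then M (R 0 + R 3) else R 6)
round b R M R4≡ φ≡ = reg (final b) , trans enter (trans test (rest b))
                   , kept0 b , kept1 b , kept3 b , kept4 b , value b
  where
  atTest : State
  atTest = run program 4 ⟨ 4 , R , M ⟩
  branch : ℕ → State
  branch z = ⟨ (if z ≡ᵇ 0 then 15 else 9) , reg atTest , M ⟩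
  final : Bool → State
  final b = run program 6 (branch (bit b))
  -- The run computes by itself except at the two conditional jumps; enter and
  -- test decide these by the hypotheses on R 4 and on the value read.
  enter : run program 12 ⟨ 3 , R , M ⟩ ≡ run program 11 ⟨ 4 , R , M ⟩
  enter = cong (λ z → run program 11 ⟨ (if z ≡ᵇ 0 then 16 else 4) , R , M ⟩) R4≡
  test : run program 11 ⟨ 4 , R , M ⟩ ≡ final b
  test = cong (run program 6 ∘ branch) φ≡
  rest : ∀ b → final b ≡ ⟨ 3 , reg (final b) , M [ R 1 + R 1 + M (R 0 + R 3) ≔ reg (final b) 6 ] ⟩
  rest true  = refl
  rest false = refl
  kept0 : ∀ b → reg (final b) 0 ≡ R 0
  kept0 true  = refl
  kept0 false = refl
  kept1 : ∀ b → reg (final b) 1 ≡ R 1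
  kept1 true  = refl
  kept1 false = refl
  kept3 : ∀ b → reg (final b) 3 ≡ R 0 + R 3
  kept3 true  = refl
  kept3 false = refl
  kept4 : ∀ b → reg (final b) 4 ≡ R 4 ∸ R 0
  kept4 true  = refl
  kept4 false = refl
  value : ∀ b → reg (final b) 6 ≡ (if b then M (R 0 + R 3) else R 6)
  value true  = refl
  value false = refl

------------------------------------------------------------------------
-- Correctness and running time

module _ {n k : ℕ} (P : IdempotentPermutation n k) (f : Fin n → Fin n) where
  open IdempotentPermutation P hiding (Corresponding; Formula)

  input-π⁻ : ∀ i → nth 0 (input P) (val i) ≡ val (π⁻ i)
  input-π⁻ i = nth-tabulate-++ 0 (val ∘ π⁻) _ i

  input-φ⁻ : ∀ i → nth 0 (input P) (n + val i) ≡ bit (φ⁻ i)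
  input-φ⁻ i rewrite +-suc n (toℕ i) =
    trans (nth-drop 0 (val ∘ π⁻) _ (toℕ i)) (nth-tabulate 0 (bit ∘ φ⁻) i)

  input-beyond : ∀ (x : Fin n) → nth 0 (input P) (n + n + val x) ≡ 0
  input-beyond x rewrite +-suc (n + n) (toℕ x) | +-assoc n n (toℕ x) =
    trans (nth-drop 0 (val ∘ π⁻) _ (n + toℕ x)) (nth-beyond 0 (bit ∘ φ⁻) (toℕ x))

  -- The state s at the head of the loop after j rounds.
  record Invariant (j : ℕ) (s : State) : Set where
    field
      atHead    : pc s ≡ 3
      one       : reg s 0 ≡ 1
      size      : reg s 1 ≡ n
      index     : reg s 3 ≡ j
      counter   : reg s 4 ≡ n ∸ j
      -- Void for j = 0, when no value has been computed yet.
      current   : ∀ i → val i ≡ j → reg s 6 ≡ val (f (π⁻ i))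
      inputKept : ∀ m → m ≤ n + n → mem s m ≡ nth 0 (input P) m
      written   : ∀ i → toℕ i < j → output P s (π⁻ i) ≡ val (f (π⁻ i))
      unwritten : ∀ i → j ≤ toℕ i → output P s (π⁻ i) ≡ 0

  initial : Invariant 0 (run program 3 (start P))
  initial = record
    { atHead    = refl
    ; one       = refl
    ; size      = refl
    ; index     = refl
    ; counter   = refl
    ; current   = λ i ()
    ; inputKept = λ m _ → refl
    ; written   = λ i ()
    ; unwritten = λ i _ → input-beyond (π⁻ i)
    }

  invariant⇒output : ∀ (i : Fin n) {s} → Invariant (val i) s → ∀ j → output P s (π⁻ j) ≡
                     (if does (j Fin.≤? i) then val (f (π⁻ j)) else 0)
  invariant⇒output i {s} inv j = cases (j Fin.≤? i)
    where
    cases : (j≤?i : Dec (j Fin.≤ i)) →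
            output P s (π⁻ j) ≡ (if does j≤?i then val (f (π⁻ j)) else 0)
    cases (yes j≤i) = Invariant.written inv j (s≤s j≤i)
    cases (no  j≰i) = Invariant.unwritten inv j (≰⇒> j≰i)

  module _ (F : Formula P f) where

    preserved : ∀ i s → Invariant (toℕ i) s → Invariant (suc (toℕ i)) (run program 12 s)
    preserved i ⟨ l , R , M ⟩
      record { atHead = refl ; one = one ; size = size ; index = index ; counter = counter
             ; current = current ; inputKept = inputKept
             ; written = written ; unwritten = unwritten }
      = subst (Invariant (suc (toℕ i))) (sym state≡) next
      where
      next-index : R 0 + R 3 ≡ val i
      next-index = cong₂ _+_ one index

      readπ : M (R 0 + R 3) ≡ val (π⁻ i)
      readπ = trans (cong M next-index)
                (trans (inputKept (val i) (≤-trans (toℕ<n i) (m≤m+n n n))) (input-π⁻ i))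

      readφ : M (R 1 + (R 0 + R 3)) ≡ bit (φ⁻ i)
      readφ = trans (cong M (cong₂ _+_ size next-index))
                (trans (inputKept (n + val i) (+-monoʳ-≤ n (toℕ<n i))) (input-φ⁻ i))

      effect = round (φ⁻ i) R M (trans counter (+-∸-assoc 1 (toℕ<n i))) readφ
      R′     = proj₁ effect
      state≡ = proj₁ (proj₂ effect)
      regs   = proj₂ (proj₂ effect)
      value  = proj₂ (proj₂ (proj₂ (proj₂ regs)))

      address : R 1 + R 1 + M (R 0 + R 3) ≡ n + n + val (π⁻ i)
      address = cong₂ _+_ (cong₂ _+_ size size) readπ

      M′ : ℕ → ℕ
      M′ = M [ R 1 + R 1 + M (R 0 + R 3) ≔ R′ 6 ]

      value′ : R′ 6 ≡ val (f (π⁻ i))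
      value′ = trans value choose
        where
        choose : (if φ⁻ i then M (R 0 + R 3) else R 6) ≡ val (f (π⁻ i))
        choose with φ⁻ i in φ≡
        ... | true  = trans readπ (cong val (sym (formula-true P f F i φ≡)))
        ... | false = trans (current (Fin.pred i) (sym (suc-injective (val-pred P i φ≡))))
                            (cong val (sym (formula-false P f F i φ≡)))

      M′-new : M′ (n + n + val (π⁻ i)) ≡ val (f (π⁻ i))
      M′-new = trans (cong M′ (sym address)) (trans (update-same M _ (R′ 6)) value′)

      M′-old : ∀ {m} → m ≢ n + n + val (π⁻ i) → M′ m ≡ M m
      M′-old m≢ = update-other M (R′ 6) λ eq → m≢ (trans eq address)

      M′-output : ∀ {j} → j ≢ i → M′ (n + n + val (π⁻ j)) ≡ M (n + n + val (π⁻ j))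
      M′-output j≢i = M′-old λ eq →
        j≢i (π⁻-injective P (toℕ-injective (suc-injective (+-cancelˡ-≡ (n + n) _ _ eq))))

      written′ : ∀ j → toℕ j < suc (toℕ i) → M′ (n + n + val (π⁻ j)) ≡ val (f (π⁻ j))
      written′ j j<1+i with j Fin.≟ i
      ... | yes refl = M′-new
      ... | no  j≢i  = trans (M′-output j≢i)
                         (written j (≤∧≢⇒< (s≤s⁻¹ j<1+i) (j≢i ∘ toℕ-injective)))

      next : Invariant (suc (toℕ i)) ⟨ 3 , R′ , M′ ⟩
      next = record
        { atHead    = refl
        ; one       = trans (proj₁ regs) one
        ; size      = trans (proj₁ (proj₂ regs)) size
        ; index     = trans (proj₁ (proj₂ (proj₂ regs))) next-index
        ; counter   = trans (proj₁ (proj₂ (proj₂ (proj₂ regs))))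
                        (trans (cong₂ _∸_ counter one) (pred[m∸n]≡m∸[1+n] n (toℕ i)))
        ; current   = λ j j≡ → trans value′
                        (cong (val ∘ f ∘ π⁻) (toℕ-injective (suc-injective (sym j≡))))
        ; inputKept = λ m m≤2n → trans
                        (M′-old (<⇒≢ (≤-<-trans m≤2n (m<m+n (n + n) z<s))))
                        (inputKept m m≤2n)
        ; written   = written′
        ; unwritten = λ j i<j → trans (M′-output (λ j≡i → <⇒≢ i<j (cong toℕ (sym j≡i))))
                        (unwritten j (<⇒≤ i<j))
        }

    rounds : ∀ t j {s} → t + j ≤ n → Invariant j s → Invariant (t + j) (run program (t * 12) s)
    rounds zero    j     t+j≤n inv = inv
    rounds (suc t) j {s} t+j<n inv =
      subst (λ m → Invariant m (run program (suc t * 12) s)) (+-suc t j)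
        (rounds t (suc j) (subst (_≤ n) (sym (+-suc t j)) t+j<n) inv′)
      where
      j<n : j < n
      j<n = ≤-trans (s≤s (m≤n+m j t)) t+j<n
      inv′ : Invariant (suc j) (run program 12 s)
      inv′ = subst (λ m → Invariant (suc m) (run program 12 s)) (toℕ-fromℕ< j<n)
               (preserved (fromℕ< j<n) s
                 (subst (λ m → Invariant m s) (sym (toℕ-fromℕ< j<n)) inv))

    -- Three instructions for the initialisation, twelve for each round.
    afterRounds : ∀ t → t ≤ n → Invariant t (run program (3 + t * 12) (start P))
    afterRounds t t≤n = subst (λ m → Invariant m (run program (3 + t * 12) (start P))) (+-identityʳ t)
      (rounds t 0 (subst (_≤ n) (sym (+-identityʳ t)) t≤n) initial)

    exit : ∀ s → Invariant n s → run program 1 s ≡ ⟨ 16 , reg s , mem s ⟩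
    exit ⟨ _ , R , M ⟩ record { atHead = refl ; counter = counter } =
      cong (λ z → ⟨ (if z ≡ᵇ 0 then 16 else 4) , R , M ⟩) (trans counter (n∸n≡0 n))

    evaluates : Evaluates P program (16 * n) f
    evaluates = record
      { stage            = stage
      ; stage-increasing = λ i<j → +-monoʳ-< 3 (*-monoˡ-< 12 (s≤s i<j))
      ; stage-output     = stage-output
      ; time             = total
      ; stage≤time       = λ i → +-monoʳ-≤ 3 (≤-trans (*-monoˡ-≤ 12 (toℕ<n i)) (m≤m+n (n * 12) 1))
      ; time≤T           = total≤16n
      ; halted           = cong (fetch program) final≡
      ; result           = result
      }
      where
      stage : Fin n → ℕ
      stage i = 3 + val i * 12

      total : ℕ
      total = 3 + (n * 12 + 1)

      stage-output : ∀ i j → output P (run program (stage i) (start P)) (π⁻ j) ≡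
                             (if does (j Fin.≤? i) then val (f (π⁻ j)) else 0)
      stage-output i j = invariant⇒output i (afterRounds (val i) (toℕ<n i)) j

      total≤16n : total ≤ 16 * n
      total≤16n = begin
        3 + (n * 12 + 1)  ≡⟨ +-comm 3 (n * 12 + 1) ⟩
        n * 12 + 1 + 3    ≡⟨ +-assoc (n * 12) 1 3 ⟩
        n * 12 + 1 * 4    ≤⟨ +-monoʳ-≤ (n * 12) (*-monoˡ-≤ 4 (≤-trans 1≤k k≤n)) ⟩
        n * 12 + n * 4    ≡⟨ *-distribˡ-+ n 12 4 ⟨
        n * 16            ≡⟨ *-comm n 16 ⟩
        16 * n            ∎
        where open ≤-Reasoning

      last : State
      last = run program (3 + n * 12) (start P)

      final≡ : run program total (start P) ≡ ⟨ 16 , reg last , mem last ⟩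
      final≡ = trans (run-+ program (3 + n * 12) 1 (start P)) (exit last (afterRounds n ≤-refl))

      result : ∀ x → output P (run program total (start P)) x ≡ val (f x)
      result x = trans (cong (λ s → output P s x) final≡)
        (subst (λ y → output P last y ≡ val (f y)) (π⁻-π P x)
          (Invariant.written (afterRounds n ≤-refl) (π ⟨$⟩ʳ x) (toℕ<n (π ⟨$⟩ʳ x))))

theorem3p14 : (∀ {n k : ℕ} (P : IdempotentPermutation n k) (ι : IdempotentMap n k) → Corresponding P ι →
    Formula P (map ι) × (∀ (f : Fin n → Fin n) → Formula P f → f ≗ map ι))
    × (∃[ p ] ∃[ C ] ∀ {n k : ℕ} (P : IdempotentPermutation n k) (ι : IdempotentMap n k) →
    Corresponding P ι → Evaluates P p (C * n) (map ι))
theorem3p14 =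
    (λ P ι corr → corresponding⇒formula P ι corr
                , λ f F → formula-unique P f (map ι) F (corresponding⇒formula P ι corr))
  , program , 16 , λ P ι corr → evaluates P (map ι) (corresponding⇒formula P ι corr)
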